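{- The logic $\mathsf{C2.FS}$ is weakly complete for finite $\omega$-sequence frames: for every $p\in\mathcal{L}_>$, if $p$ is true at every element of every order model based on a finite $\omega$-sequence frame, then $\vdash_{\mathsf{C2.FS}}p$.
   Context: Language. Let $At=\{p_0,p_1,\ldots\}$ be a countably infinite set of atoms. $\mathcal{L}_>$ is generated by $p ::= p_k\in At\mid \neg p\mid (p\wedge p)\mid (p>p)$; $\vee,\to,\leftrightarrow$ are defined as usual; $\Box p$ abbreviates $\neg p>p$. Logics. $\mathsf{C2}$ is the smallest set of $\mathcal{L}_>$-sentences containing all instances of: (PC) every (substitution instance of a) theorem of classical propositional logic; (Identity) $p>p$; (Reciprocity) $(p>q)\wedge(q>p)\wedge(p>r)\to(q>r)$; (MP) $(p>q)\to(p\to q)$; (CEM) $(p>q)\vee(p>\neg q)$; and closed under (Detachment) from $\vdash p\to q$ and $\vdash p$ infer $\vdash q$; (Normality) from $\vdash(p\wedge q)\to r$ infer $\vdash((s>p)\wedge(s>q))\to(s>r)$. $\mathsf{C2.FS}$ is the smallest extension of $\mathsf{C2}$ closed under Detachment and Normality and containing every instance of (Flattening) $(p>((p\wedge q)>r))\leftrightarrow((p\wedge q)>r)$ and of (Sequentiality) $\Box(p\to(\neg p>r))\wedge\Box(q\to(\neg q>r))\to((p\vee q)\to(\neg(p\vee q)>r))$. $\vdash_{\mathsf{C2.FS}}p$ means $p\in\mathsf{C2.FS}$. Order frames and models. An order frame is a pair $\langle W,<\rangle$ where $W\neq\varnothing$ and $<$ is a function taking each $w\in W$ to a strict well-order $<_w$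 on some subset of $W$ such that whenever $x<_w y$, either $w=x$ or $w<_w x$. Put $R(w)=\{w\}\cup\{v: w<_w v\}$. An order model $\langle W,<,V\rangle$ adds a valuation $V:At\times W\to\{0,1\}$; put $V(p_k)=\{w:V(p_k,w)=1\}$. Denotations: $[\![p_k]\!]=V(p_k)$, $[\![\neg p]\!]=W\setminus[\![p]\!]$, $[\![p\wedge q]\!]=[\![p]\!]\cap[\![q]\!]$, and $w\in[\![p>q]\!]$ iff either $R(w)\cap[\![p]\!]=\varnothing$, or there is $y\in R(w)\cap[\![p]\!]\cap[\![q]\!]$ such that $x\notin[\![p]\!]$ whenever $x<_w y$. A sentence $p$ is true at $w$ iff $w\in[\![p]\!]$. $\omega$-sequence frames. An $\omega$-sequence over a non-empty set $P$ is a function $\sigma:\omega\to P$; its $n$th tail $\sigma^{[n:]}$ is the $\omega$-sequence $k\mapsto\sigma(n+k)$; the rank in $\sigma$ of a tail $\tau$ of $\sigma$ is the least $n$ with $\tau=\sigma^{[n:]}$. The tail order function $\prec^W$ on a set $W$ of sequences has $\tau\prec^W_\sigma\rho$ iff $\tau,\rho,\sigma\in W$, $\tau$ and $\rho$ are tails of $\sigma$, and the rank of $\tau$ in $\sigma$ is less than the rank of $\rho$ in $\sigma$. An $\omega$-sequence frame is an order frame $\langle W,\prec^W\rangle$ where $W$ is a set of $\omega$-sequences over some set $P$ that is closed under tails. It is finite iff $W$ is finite. -}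

module Defs where

open import Level using (0ℓ)
open import Data.Bool.Base using (Bool; true; not) renaming (_∧_ to _∧ᵇ_)
open import Data.Fin.Base using (Fin)
open import Data.Nat.Base using (ℕ; _+_; _≤_; _<_)
open import Data.Product.Base using (Σ; ∃; ∃₂; _×_; proj₁)
open import Data.Sum.Base using (_⊎_)
open import Function.Base using (_on_)
open import Function.Bundles using (Inverse)
open import Induction.WellFounded using (WellFounded)
open import Relation.Binary.Bundles using (Setoid)
open import Relation.Binary.Core using (Rel)
open import Relation.Binary.Definitions using (_Respects_)
open import Relation.Binary.Structures using (IsStrictTotalOrder)
import Relation.Binary.Construct.On as On
open import Relation.Binary.PropositionalEquality
  using (_≡_; _≗_; _→-setoid_) renaming (setoid to ≡-setoid)
open import Relation.Unary using (Pred; Empty; ∁; _∈_; _∉_; _∩_)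

infix  10 ~_
infix  10 □_
infixr 8 _∧_
infixr 7 _∨_
infix  6 _>_
infixr 5 _⇒_
infix  4 _⇔_

data Form : Set where
  atom : ℕ → Form
  ~_   : Form → Form
  _∧_  : Form → Form → Form
  _>_  : Form → Form → Form

_∨_ _⇒_ _⇔_ : Form → Form → Form
p ∨ q = ~ (~ p ∧ ~ q)
p ⇒ q = ~ (p ∧ ~ q)
p ⇔ q = (p ⇒ q) ∧ (q ⇒ p)

□_ : Form → Form
□ p = ~ p > p

data PropForm : Set where
  var  : ℕ → PropForm
  neg  : PropForm → PropForm
  conj : PropForm → PropForm → PropForm

eval : (ℕ → Bool) → PropForm → Bool
eval v (var k)    = v k
eval v (neg φ)    = not (eval v φ)
eval v (conj φ ψ) = eval v φ ∧ᵇ eval v ψ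

Tautology : PropForm → Set
Tautology φ = ∀ v → eval v φ ≡ true

substitute : (ℕ → Form) → PropForm → Form
substitute s (var k)    = s k
substitute s (neg φ)    = ~ substitute s φ
substitute s (conj φ ψ) = substitute s φ ∧ substitute s ψ

data C2 : Pred Form 0ℓ where
  PC          : ∀ φ (s : ℕ → Form) → Tautology φ → C2 (substitute s φ)
  Identity    : ∀ p → C2 (p > p)
  Reciprocity : ∀ p q r → C2 ((p > q) ∧ (q > p) ∧ (p > r) ⇒ (q > r))
  MP          : ∀ p q → C2 ((p > q) ⇒ (p ⇒ q))
  CEM         : ∀ p q → C2 ((p > q) ∨ (p > ~ q))
  Detachment  : ∀ p q → C2 (p ⇒ q) → C2 p → C2 q
  Normality   : ∀ p q r s → C2 (p ∧ q ⇒ r) → C2 ((s > p) ∧ (s > q) ⇒ (s > r))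

data C2FS : Pred Form 0ℓ where
  fromC2        : ∀ p → C2 p → C2FS p
  Flattening    : ∀ p q r → C2FS ((p > (p ∧ q > r)) ⇔ (p ∧ q > r))
  Sequentiality : ∀ p q r →
    C2FS (□ (p ⇒ (~ p > r)) ∧ □ (q ⇒ (~ q > r)) ⇒ (p ∨ q ⇒ (~ (p ∨ q) > r)))
  Detachment    : ∀ p q → C2FS (p ⇒ q) → C2FS p → C2FS q
  Normality     : ∀ p q r s →
    C2FS (p ∧ q ⇒ r) → C2FS ((s > p) ∧ (s > q) ⇒ (s > r))

infix 3 ⊢C2FS_

⊢C2FS_ : Form → Set
⊢C2FS p = C2FS p

-- Worlds form a setoid, so that ω-sequences can be compared pointwise;
-- accordingly orders, subsets and valuations respect its equality.

module _ (S : Setoid 0ℓ 0ℓ) where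
  open Setoid S renaming (Carrier to W)

  -- Well-ordering is total order plus well-foundedness in the sense of
  -- accessibility, classically the same as every non-empty subset having
  -- a least element.
  record IsStrictWellOrderOn (D : Pred W 0ℓ) (_<ᵂ_ : Rel W 0ℓ) : Set where
    field
      respects           : D Respects _≈_
      on-subset          : ∀ {x y} → x <ᵂ y → x ∈ D × y ∈ D
      isStrictTotalOrder : IsStrictTotalOrder {A = ∃ D} (_≈_ on proj₁) (_<ᵂ_ on proj₁)
      wellFounded        : WellFounded {A = ∃ D} (_<ᵂ_ on proj₁)

  -- lt w x y  is  x <_w y.
  record IsOrderFrame (lt : W → Rel W 0ℓ) : Set₁ where
    field
      nonempty  : W
      lt-cong   : ∀ {w w′ x y} → w ≈ w′ → lt w x y → lt w′ x y
      wellOrder : ∀ w → Σ (Pred W 0ℓ) λ D → IsStrictWellOrderOn D (lt w)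
      centered  : ∀ {w x y} → lt w x y → w ≈ x ⊎ lt w w x

record OrderFrame : Set₁ where
  field
    worlds       : Setoid 0ℓ 0ℓ
    lt           : Setoid.Carrier worlds → Rel (Setoid.Carrier worlds) 0ℓ
    isOrderFrame : IsOrderFrame worlds lt

  open Setoid worlds public using (_≈_) renaming (Carrier to W)
  open IsOrderFrame isOrderFrame public

  R : W → Pred W 0ℓ
  R w v = v ≈ w ⊎ lt w w v

record Valuation (F : OrderFrame) : Set where
  open OrderFrame F
  field
    val      : ℕ → W → Bool
    val-cong : ∀ k {w w′} → w ≈ w′ → val k w ≡ val k w′

record OrderModel : Set₁ where
  field
    frame     : OrderFrame
    valuation : Valuation frame

  open OrderFrame frame public
  open Valuation valuation public

  ⟦_⟧ : Form → Pred W 0ℓ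
  ⟦ atom k ⟧ w = val k w ≡ true
  ⟦ ~ p ⟧      = ∁ ⟦ p ⟧
  ⟦ p ∧ q ⟧    = ⟦ p ⟧ ∩ ⟦ q ⟧
  ⟦ p > q ⟧ w  =
    Empty (R w ∩ ⟦ p ⟧) ⊎
    ∃ λ y → y ∈ R w ∩ ⟦ p ⟧ ∩ ⟦ q ⟧ × (∀ x → lt w x y → x ∉ ⟦ p ⟧)

model : (F : OrderFrame) → Valuation F → OrderModel
model F V = record { frame = F ; valuation = V }

TrueAt : (M : OrderModel) → OrderModel.W M → Form → Set
TrueAt M w p = w ∈ OrderModel.⟦_⟧ M p

tail : {P : Set} → ℕ → (ℕ → P) → (ℕ → P)
tail n σ k = σ (n + k)

-- The rank of τ in σ is n; in particular τ is a tail of σ.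
IsRank : {P : Set} → (σ τ : ℕ → P) → ℕ → Set
IsRank σ τ n = τ ≗ tail n σ × (∀ m → τ ≗ tail m σ → n ≤ m)

-- The set W of sequences is represented by ∃ W with pointwise equality.
sequences : {P : Set} → Pred (ℕ → P) 0ℓ → Setoid 0ℓ 0ℓ
sequences {P} W = On.setoid {B = ∃ W} (ℕ →-setoid P) proj₁

tailOrder : {P : Set} (W : Pred (ℕ → P) 0ℓ) → ∃ W → Rel (∃ W) 0ℓ
tailOrder W σ τ ρ = ∃₂ λ m n →
  IsRank (proj₁ σ) (proj₁ τ) m × IsRank (proj₁ σ) (proj₁ ρ) n × m < n

-- P is non-empty because W is.  Given W non-empty, isOrderFrame holds
-- automatically in classical logic; constructively it also says that ranks
-- of tails exist and that equality of tails is decidable.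
record ωSequenceFrame : Set₁ where
  field
    P            : Set
    W            : Pred (ℕ → P) 0ℓ
    W-resp       : W Respects _≗_
    closed       : ∀ n {σ} → σ ∈ W → tail n σ ∈ W
    isOrderFrame : IsOrderFrame (sequences W) (tailOrder W)

  orderFrame : OrderFrame
  orderFrame = record { isOrderFrame = isOrderFrame }

  Finite : Set
  Finite = ∃ λ n → Inverse (sequences W) (≡-setoid (Fin n))

{-# OPTIONS --safe #-}

-- C2.FS is a temporal logic of until without next: on ω-sequences p > q says
-- that the first tail satisfying p, if any, satisfies q.  Completeness follows
-- the pattern of elimination of types.  A type decides p and its conditional
-- subformulas; τ ⟶ τ′ if no conditional whose antecedent fails in τ changes its
-- value.  By Flattening, the first world not of type τ has a ⟶-successor of τ
-- as its type, and by Sequentiality a ⟶-closed set of types is never left.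
-- Hence a type is refutable if it rejects a > b although no a-type is
-- ⟶-reachable from it.  After deletion of the refutable types, a scheduler that
-- walks in turn towards each reachable antecedent is a deterministic step
-- function on finitely many states, whose orbits form a finite ω-sequence frame
-- in which every remaining type is the truth set of some world.

module Submission where

open import Defs
open ωSequenceFrame using (orderFrame; Finite)
open OrderFrame using (W)

open import Level using (0ℓ)
open import Data.Bool.Base using (Bool; true; false; not; if_then_else_) renaming (_∧_ to _∧ᵇ_)
import Data.Bool.Properties as Bool
open import Data.Fin.Base using (Fin; zero; suc; toℕ; fromℕ; inject₁)
import Data.Fin.Properties as Fin
open import Data.Fin.Induction using (<-weakInduction; >-weakInduction)
open import Data.List.Base
  using (List; []; _∷_; _++_; map; filter; length; lookup; removeAt; allFin;
         cartesianProduct; concatMap)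
open import Data.List.Properties using (length-removeAt′)
open import Data.List.Membership.Propositional using (_∈_; lose)
open import Data.List.Membership.Propositional.Properties
  using (∈-++⁺ˡ; ∈-++⁺ʳ; ∈-map⁺; ∈-map⁻; ∈-filter⁺; ∈-filter⁻; ∈-allFin; ∈-cartesianProduct⁺;
         ∈-concatMap⁺; ∈-lookup)
open import Data.List.Relation.Binary.Subset.Propositional using (_⊆_)
open import Data.List.Relation.Unary.Any using (here; there; index)
import Data.List.Relation.Unary.Any.Properties as Any
open import Data.Nat.Base using (ℕ; zero; suc; _+_; _≤_; _≤′_; ≤′-refl; ≤′-step; _<_; z≤n; s≤s)
open import Data.Nat.GeneralisedArithmetic using (fold)
open import Data.Nat.Induction using (<-wellFounded)
import Data.Nat.Properties as ℕ
import Data.Product.Base as Prod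
open import Data.Product.Base using (∃; _×_; _,_; proj₁; proj₂)
import Data.Sum.Base as Sum
open import Data.Sum.Base using (_⊎_; inj₁; inj₂; [_,_]′)
open import Data.Product.Function.NonDependent.Propositional using (_×-↔_)
open import Function.Base using (_∘_; id)
open import Function.Bundles using (_↔_; Inverse)
open import Function.Properties.Inverse using (↔-refl; ↔-trans)
open import Induction.WellFounded using (Acc; acc; module Subrelation)
import Relation.Binary.Construct.On as On
open import Relation.Binary.Bundles using (Setoid)
open import Relation.Binary.Core using (Rel)
open import Relation.Binary.Definitions
  using (DecidableEquality; Reflexive; Tri; tri<; tri≈; tri>; _Respects_)
import Relation.Binary.Definitions as Binary
open import Relation.Binary.PropositionalEquality
  using (_≡_; _≢_; _≗_; refl; sym; trans; cong; cong₂; subst; subst₂)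
open import Relation.Nullary using (¬_; Dec; yes; no; does; contradiction)
open import Relation.Nullary.Decidable using (map′; ¬?; _×-dec_; _→-dec_; dec-true; decidable-stable)
open import Relation.Unary using (Pred; Decidable)

-- Propositional reasoning

private
  variable
    p q r s a b : Form

infix 4 _≟_

_≟_ : DecidableEquality Form
atom k  ≟ atom l    = map′ (cong atom) (λ { refl → refl }) (k ℕ.≟ l)
(~ p)   ≟ (~ q)     = map′ (cong ~_) (λ { refl → refl }) (p ≟ q)
(p ∧ q) ≟ (p′ ∧ q′) =
  map′ (λ { (refl , refl) → refl }) (λ { refl → refl , refl }) ((p ≟ p′) ×-dec (q ≟ q′))
(p > q) ≟ (p′ > q′) =
  map′ (λ { (refl , refl) → refl }) (λ { refl → refl , refl }) ((p ≟ p′) ×-dec (q ≟ q′))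
atom _  ≟ (~ _)     = no λ ()
atom _  ≟ (_ ∧ _)   = no λ ()
atom _  ≟ (_ > _)   = no λ ()
(~ _)   ≟ atom _    = no λ ()
(~ _)   ≟ (_ ∧ _)   = no λ ()
(~ _)   ≟ (_ > _)   = no λ ()
(_ ∧ _) ≟ atom _    = no λ ()
(_ ∧ _) ≟ (~ _)     = no λ ()
(_ ∧ _) ≟ (_ > _)   = no λ ()
(_ > _) ≟ atom _    = no λ ()
(_ > _) ≟ (~ _)     = no λ ()
(_ > _) ≟ (_ ∧ _)   = no λ ()

open import Data.List.Membership.DecPropositional _≟_ using (_∈?_)

-- Truth in an assignment that treats conditionals, like atoms, as
-- unanalysed; the values of h at negations and conjunctions are ignored.

infix 4 _⊩_ _⊩?_

_⊩_ : (Form → Bool) → Pred Form 0ℓ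
h ⊩ atom k = h (atom k) ≡ true
h ⊩ ~ p    = ¬ (h ⊩ p)
h ⊩ p ∧ q  = (h ⊩ p) × (h ⊩ q)
h ⊩ p > q  = h (p > q) ≡ true

_⊩?_ : ∀ h → Decidable (h ⊩_)
h ⊩? atom k  = h (atom k) Bool.≟ true
h ⊩? ~ p     = ¬? (h ⊩? p)
h ⊩? (p ∧ q) = (h ⊩? p) ×-dec (h ⊩? q)
h ⊩? (p > q) = h (p > q) Bool.≟ true

⊩-⇒⁺ : ∀ h p q → (h ⊩ p → h ⊩ q) → h ⊩ p ⇒ q
⊩-⇒⁺ h p q f (hp , ¬hq) = ¬hq (f hp)

⊩-⇒⁻ : ∀ h p q → h ⊩ p ⇒ q → h ⊩ p → h ⊩ q
⊩-⇒⁻ h p q hpq hp = decidable-stable (h ⊩? q) λ ¬hq → hpq (hp , ¬hq)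

⊩-∨⁻ : ∀ h p q → h ⊩ p ∨ q → h ⊩ p ⊎ h ⊩ q
⊩-∨⁻ h p q hpq with h ⊩? p | h ⊩? q
... | yes hp | _      = inj₁ hp
... | no  _  | yes hq = inj₂ hq
... | no ¬hp | no ¬hq = contradiction (¬hp , ¬hq) hpq

-- From validity over assignments to instances of `PC`.

modals : Form → List Form
modals (atom k) = atom k ∷ []
modals (~ p)    = modals p
modals (p ∧ q)  = modals p ++ modals q
modals (p > q)  = (p > q) ∷ []

position : List Form → Form → ℕ
position []      u = 0
position (v ∷ M) u = if does (v ≟ u) then 0 else suc (position M u)

nth : List Form → ℕ → Form
nth []      _       = atom 0
nth (u ∷ M) zero    = u
nth (u ∷ M) (suc k) = nth M k

nth-position : ∀ {M u} → u ∈ M → nth M (position M u) ≡ u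
nth-position {v ∷ M} {u} u∈ with v ≟ u
nth-position             u∈         | yes v≡u = v≡u
nth-position             (here u≡v) | no  v≢u = contradiction (sym u≡v) v≢u
nth-position             (there u∈) | no  v≢u = nth-position u∈

encode : List Form → Form → PropForm
encode M (~ p)      = neg (encode M p)
encode M (p ∧ q)    = conj (encode M p) (encode M q)
encode M (atom k)   = var (position M (atom k))
encode M (p > q)    = var (position M (p > q))

substitute-encode : ∀ {M} p → modals p ⊆ M → substitute (nth M) (encode M p) ≡ p
substitute-encode (atom k) ⊆M = nth-position (⊆M (here refl))
substitute-encode (~ p)    ⊆M = cong ~_ (substitute-encode p ⊆M)
substitute-encode (p ∧ q)  ⊆M =
  cong₂ _∧_ (substitute-encode p (⊆M ∘ ∈-++⁺ˡ)) (substitute-encode q (⊆M ∘ ∈-++⁺ʳ (modals p)))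
substitute-encode (p > q)  ⊆M = nth-position (⊆M (here refl))

does-≟-true : ∀ x → x ≡ does (x Bool.≟ true)
does-≟-true true  = refl
does-≟-true false = refl

eval-encode : ∀ M v p → eval v (encode M p) ≡ does ((v ∘ position M) ⊩? p)
eval-encode M v (atom k) = does-≟-true _
eval-encode M v (~ p)    = cong not (eval-encode M v p)
eval-encode M v (p ∧ q)  = cong₂ _∧ᵇ_ (eval-encode M v p) (eval-encode M v q)
eval-encode M v (p > q)  = does-≟-true _

infix 3 ⊢_

⊢_ : Form → Set
⊢ p = ⊢C2FS p

-- `PC` speaks of schemata, so `p` is presented as the instance of one whose variables are positions
-- in `modals p`. A valuation `v` of these variables amounts to the assignment `v ∘ position M`, to
-- which `valid` applies.
tautology : (∀ h → h ⊩ p) → ⊢ p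
tautology {p} valid = subst C2FS (substitute-encode p id)
  (fromC2 _ (PC (encode M p) (nth M) λ v →
    trans (eval-encode M v p) (dec-true (_ ⊩? p) (valid _))))
  where M = modals p

infer : (∀ h → h ⊩ p → h ⊩ q) → ⊢ p → ⊢ q
infer {p} {q} f = Detachment p q (tautology λ h → ⊩-⇒⁺ h p q (f h))

infer₂ : (∀ h → h ⊩ p → h ⊩ q → h ⊩ r) → ⊢ p → ⊢ q → ⊢ r
infer₂ {p} {q} {r} f ⊢p =
  Detachment q r (infer (λ h hp → ⊩-⇒⁺ h q r (f h hp)) ⊢p)

⇒-trans : ⊢ p ⇒ q → ⊢ q ⇒ r → ⊢ p ⇒ r
⇒-trans {p} {q} {r} = infer₂ λ h pq qr → ⊩-⇒⁺ h p r (⊩-⇒⁻ h q r qr ∘ ⊩-⇒⁻ h p q pq)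

⇒-∧ : ⊢ p ⇒ q → ⊢ p ⇒ r → ⊢ p ⇒ q ∧ r
⇒-∧ {p} {q} {r} = infer₂ λ h pq pr → ⊩-⇒⁺ h p (q ∧ r) λ hp → ⊩-⇒⁻ h p q pq hp , ⊩-⇒⁻ h p r pr hp

⇔-to : ⊢ p ⇔ q → ⊢ p ⇒ q
⇔-to = infer λ _ → proj₁

⇔-from : ⊢ p ⇔ q → ⊢ q ⇒ p
⇔-from = infer λ _ → proj₂

⇔-intro : ⊢ p ⇒ q → ⊢ q ⇒ p → ⊢ p ⇔ q
⇔-intro = infer₂ λ _ → _,_

contraposition : ⊢ p ⇒ q → ⊢ ~ q ⇒ ~ p
contraposition {p} {q} = infer λ h pq → ⊩-⇒⁺ h (~ q) (~ p) λ ¬hq → ¬hq ∘ ⊩-⇒⁻ h p q pq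

⇒~-sym : ⊢ p ⇒ ~ q → ⊢ q ⇒ ~ p
⇒~-sym {p} {q} = infer λ h pq → ⊩-⇒⁺ h q (~ p) λ hq hp → ⊩-⇒⁻ h p (~ q) pq hp hq

-- Conditional reasoning

>-mono : ∀ s → ⊢ p ⇒ q → ⊢ (s > p) ⇒ (s > q)
>-mono {p} {q} s pq =
  infer (λ h f → ⊩-⇒⁺ h (s > p) (s > q) λ sp → ⊩-⇒⁻ h ((s > p) ∧ (s > p)) (s > q) f (sp , sp))
    (Normality p p q s (infer (λ h f → ⊩-⇒⁺ h (p ∧ p) q (⊩-⇒⁻ h p q f ∘ proj₁)) pq))

>-∧ : ∀ p q s → ⊢ (s > p) ∧ (s > q) ⇒ (s > p ∧ q)
>-∧ p q s = Normality p q (p ∧ q) s (tautology λ h → ⊩-⇒⁺ h (p ∧ q) (p ∧ q) id)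

⇒⇒> : ⊢ p ⇒ q → ⊢ p > q
⇒⇒> {p} {q} pq = Detachment (p > p) (p > q) (>-mono p pq) (fromC2 _ (Identity p))

necessitation : ∀ p → ⊢ q → ⊢ p > q
necessitation {q} p ⊢q = ⇒⇒> (infer (λ h hq → ⊩-⇒⁺ h p q λ _ → hq) ⊢q)

>-reciprocal : ∀ r → ⊢ q > p → ⊢ (p > q) ∧ (p > r) ⇒ (q > r)
>-reciprocal {q} {p} r = infer₂
  (λ h rec qp → ⊩-⇒⁺ h ((p > q) ∧ (p > r)) (q > r) λ (pq , pr) →
    ⊩-⇒⁻ h ((p > q) ∧ (q > p) ∧ (p > r)) (q > r) rec (pq , qp , pr))
  (fromC2 _ (Reciprocity p q r))

-- Equivalent antecedents conditionally imply each other, which is what Reciprocity asks for.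
>-congˡ : ∀ r → ⊢ p ⇔ q → ⊢ (p > r) ⇒ (q > r)
>-congˡ {p} {q} r pq = infer₂
  (λ h hpq f → ⊩-⇒⁺ h (p > r) (q > r) λ pr →
    ⊩-⇒⁻ h ((p > q) ∧ (p > r)) (q > r) f (hpq , pr))
  (⇒⇒> (⇔-to pq)) (>-reciprocal r (⇒⇒> (⇔-from pq)))

centering⁻ : ∀ p q → ⊢ (p > q) ⇒ (p ⇒ q)
centering⁻ p q = fromC2 _ (MP p q)

-- CEM leaves `p > ~ q` as the only alternative, and MP rules it out in the presence of `p` and `q`.
centering⁺ : ∀ p q → ⊢ p ∧ q ⇒ (p > q)
centering⁺ p q = infer₂
  (λ h cem mp → ⊩-⇒⁺ h (p ∧ q) (p > q) λ (hp , hq) →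
    case-∨ h hp hq (⊩-∨⁻ h (p > q) (p > ~ q) cem) mp)
  (fromC2 _ (CEM p q)) (centering⁻ p (~ q))
  where
  case-∨ : ∀ h → h ⊩ p → h ⊩ q → h ⊩ p > q ⊎ h ⊩ p > ~ q → h ⊩ (p > ~ q) ⇒ (p ⇒ ~ q) → h ⊩ p > q
  case-∨ h hp hq (inj₁ pq)  mp = pq
  case-∨ h hp hq (inj₂ p~q) mp =
    contradiction hq (⊩-⇒⁻ h p (~ q) (⊩-⇒⁻ h (p > ~ q) (p ⇒ ~ q) mp p~q) hp)

-- As `r` excludes `a`, the antecedent `a` is equivalent to `~ r ∧ a`, and Flattening applies with
-- `~ r` outside: no `a`-world comes before the first `~ r`-world.
inert : ∀ b → ⊢ r ⇒ ~ a → ⊢ (a > b) ⇔ (~ r > (a > b))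
inert {r} {a} b r⇒~a = ⇔-intro
  (⇒-trans (>-congˡ b a⇔) (⇒-trans (⇔-from flat) (>-mono (~ r) (>-congˡ b ⇔a))))
  (⇒-trans (>-mono (~ r) (>-congˡ b a⇔)) (⇒-trans (⇔-to flat) (>-congˡ b ⇔a)))
  where
  flat : ⊢ (~ r > (~ r ∧ a > b)) ⇔ (~ r ∧ a > b)
  flat = Flattening (~ r) a b
  a⇔ : ⊢ a ⇔ ~ r ∧ a
  a⇔ = ⇔-intro (⇒-∧ (⇒~-sym r⇒~a) (tautology λ h → ⊩-⇒⁺ h a a id))
               (tautology λ h → ⊩-⇒⁺ h (~ r ∧ a) a proj₂)
  ⇔a : ⊢ ~ r ∧ a ⇔ a
  ⇔a = ⇔-intro (⇔-from a⇔) (⇔-to a⇔)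

-- At the first world where r fails, a conditional whose antecedent is
-- incompatible with r has kept its truth value.

persist⁺ : ∀ a b → ⊢ r ⇒ ~ a → ⊢ r ⇒ (a > b) → ⊢ r ⇒ (~ r > (a > b))
persist⁺ a b r⇒~a r⇒u = ⇒-trans r⇒u (⇔-to (inert b r⇒~a))

-- CEM p q : (p > q) ∨ (p > ~ q) unfolds to ~ (p > q) ⇒ (p > ~ q).
persist⁻ : ∀ a b → ⊢ r ⇒ ~ a → ⊢ r ⇒ ~ (a > b) → ⊢ r ⇒ (~ r > ~ (a > b))
persist⁻ {r} a b r⇒~a r⇒~u =
  ⇒-trans r⇒~u (⇒-trans (contraposition (⇔-from (inert b r⇒~a))) (fromC2 _ (CEM (~ r) (a > b))))

-- Finite disjunctions and conjunctions.

⊥f ⊤f : Form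
⊥f = atom 0 ∧ ~ atom 0
⊤f = ~ ⊥f

⋁ ⋀ : List Form → Form
⋁ []       = ⊥f
⋁ (p ∷ ps) = p ∨ ⋁ ps
⋀ []       = ⊤f
⋀ (p ∷ ps) = p ∧ ⋀ ps

⊩-⋁⁺ : ∀ h {ps} → p ∈ ps → h ⊩ p → h ⊩ ⋁ ps
⊩-⋁⁺ h (here refl) hp (¬p , _) = ¬p hp
⊩-⋁⁺ h (there p∈)  hp (_ , ¬ps) = ¬ps (⊩-⋁⁺ h p∈ hp)

⊩-⋁⁻ : ∀ h ps → h ⊩ ⋁ ps → ∃ λ p → p ∈ ps × h ⊩ p
⊩-⋁⁻ h []       (h0 , ¬h0) = contradiction h0 ¬h0
⊩-⋁⁻ h (p ∷ ps) hps with ⊩-∨⁻ h p (⋁ ps) hps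
... | inj₁ hp = p , here refl , hp
... | inj₂ hps′ with q , q∈ , hq ← ⊩-⋁⁻ h ps hps′ = q , there q∈ , hq

⊩-⋀⁻ : ∀ h {ps} → p ∈ ps → h ⊩ ⋀ ps → h ⊩ p
⊩-⋀⁻ h (here refl) (hp , _)  = hp
⊩-⋀⁻ h (there p∈)  (_ , hps) = ⊩-⋀⁻ h p∈ hps

⋁-⇒ : ∀ ps → (∀ {p} → p ∈ ps → ⊢ p ⇒ q) → ⊢ ⋁ ps ⇒ q
⋁-⇒ {q} []       f = tautology λ h → ⊩-⇒⁺ h ⊥f q λ (h0 , ¬h0) → contradiction h0 ¬h0
⋁-⇒ {q} (p ∷ ps) f = infer₂
  (λ h pq psq → ⊩-⇒⁺ h (p ∨ ⋁ ps) q λ hps →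
    [ ⊩-⇒⁻ h p q pq , ⊩-⇒⁻ h (⋁ ps) q psq ]′ (⊩-∨⁻ h p (⋁ ps) hps))
  (f (here refl)) (⋁-⇒ ps (f ∘ there))

>-⋀ : ∀ ps → (∀ {p} → p ∈ ps → ⊢ r ⇒ (s > p)) → ⊢ r ⇒ (s > ⋀ ps)
>-⋀ {r} {s} []       f =
  infer (λ h hs → ⊩-⇒⁺ h r (s > ⊤f) λ _ → hs)
    (necessitation s (tautology λ h (h0 , ¬h0) → contradiction h0 ¬h0))
>-⋀ {r} {s} (p ∷ ps) f =
  ⇒-trans (⇒-∧ (f (here refl)) (>-⋀ ps (f ∘ there))) (>-∧ p (⋀ ps) s)

-- The premises are theorems, so necessitation supplies the boxes that Sequentiality puts on them.
sequential : ⊢ p ⇒ (~ p > r) → ⊢ q ⇒ (~ q > r) → ⊢ p ∨ q ⇒ (~ (p ∨ q) > r)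
sequential {p} {r} {q} pr qr = Detachment _ _ (Sequentiality p q r)
  (infer₂ (λ _ → _,_) (necessitation _ pr) (necessitation _ qr))

sequential-⋁ : ∀ ps → (∀ {p} → p ∈ ps → ⊢ p ⇒ (~ p > r)) → ⊢ ⋁ ps ⇒ (~ ⋁ ps > r)
sequential-⋁ {r} []       f =
  tautology λ h → ⊩-⇒⁺ h ⊥f (~ ⊥f > r) λ (h0 , ¬h0) → contradiction h0 ¬h0
sequential-⋁     (p ∷ ps) f = sequential (f (here refl)) (sequential-⋁ ps (f ∘ there))

-- Under `r`, the antecedent `~ r` conditionally implies both `r` and `~ r`, hence everything, in
-- particular `a` and `b`. Since `a` implies `~ r`, Reciprocity replaces the antecedent `~ r` by
-- `a`.
vacuous : ∀ b → ⊢ r ⇒ ~ a → ⊢ r ⇒ (~ r > r) → ⊢ r ⇒ (a > b)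
vacuous {r} {a} b r⇒~a r⇒□r = ⇒-trans
  (⇒-∧ (⇒-trans r⇒absurd (>-mono (~ r) (explosion a)))
       (⇒-trans r⇒absurd (>-mono (~ r) (explosion b))))
  (>-reciprocal b (⇒⇒> (⇒~-sym r⇒~a)))
  where
  r⇒absurd : ⊢ r ⇒ (~ r > (r ∧ ~ r))
  r⇒absurd = ⇒-trans
    (⇒-∧ r⇒□r (infer (λ h hr → ⊩-⇒⁺ h r (~ r > ~ r) λ _ → hr) (fromC2 _ (Identity (~ r)))))
    (>-∧ r (~ r) (~ r))
  explosion : ∀ p → ⊢ r ∧ ~ r ⇒ p
  explosion p = tautology λ h → ⊩-⇒⁺ h (r ∧ ~ r) p λ (hr , ¬hr) → contradiction hr ¬hr

-- Types

-- A type is a list of literals deciding every member of `M`. A list with both `u` and `~ u` counts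
-- as a type; its `χ` is contradictory, so that `agree` holds for it vacuously.
Type : List Form → Set
Type M = ∃ λ ls → ∀ {u} → u ∈ M → u ∈ ls ⊎ ~ u ∈ ls

χ : ∀ {M} → Type M → Form
χ (ls , _) = ⋀ ls

⟪_⟫ : ∀ {M} → Type M → Form → Bool
⟪ ls , _ ⟫ u = does (u ∈? ls)

extend : ∀ {M} u l → l ≡ u ⊎ l ≡ ~ u → Type M → Type (u ∷ M)
extend {M} u l l≡ (ls , total) = l ∷ ls , total′
  where
  total′ : ∀ {v} → v ∈ u ∷ M → v ∈ l ∷ ls ⊎ ~ v ∈ l ∷ ls
  total′ (here refl) = Sum.map (here ∘ sym) (here ∘ sym) l≡
  total′ (there v∈)  = Sum.map there there (total v∈)

types : ∀ M → List (Type M)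
types []      = ([] , λ ()) ∷ []
types (u ∷ M) =
  map (extend u u (inj₁ refl)) (types M) ++ map (extend u (~ u) (inj₂ refl)) (types M)

types-exhaustive : ∀ h M → ∃ λ τ → τ ∈ types M × h ⊩ χ τ
types-exhaustive h []      = _ , here refl , λ (h0 , ¬h0) → contradiction h0 ¬h0
types-exhaustive h (u ∷ M) with τ , τ∈ , hτ ← types-exhaustive h M | h ⊩? u
... | yes hu = _ , ∈-++⁺ˡ (∈-map⁺ _ τ∈) , hu , hτ
... | no ¬hu = _ , ∈-++⁺ʳ _ (∈-map⁺ _ τ∈) , ¬hu , hτ

module _ {M} (τ : Type M) where

  agree-modal : ∀ h u → h ⊩ χ τ → u ∈ M → (h ⊩ u → ⟪ τ ⟫ u ≡ true) × (⟪ τ ⟫ u ≡ true → h ⊩ u)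
  agree-modal h u hτ u∈M with u ∈? proj₁ τ
  ... | yes u∈ = (λ _ → refl) , λ _ → ⊩-⋀⁻ h u∈ hτ
  ... | no  u∉ with proj₂ τ u∈M
  ...   | inj₁ u∈  = contradiction u∈ u∉
  ...   | inj₂ ~u∈ = (λ hu → contradiction hu (⊩-⋀⁻ h ~u∈ hτ)) , λ ()

  -- The literals of `τ` fix the verdict of `h` on all of `M`, and truth of `p` depends only on
  -- `modals p`.
  agree : ∀ h p → h ⊩ χ τ → modals p ⊆ M → (h ⊩ p → ⟪ τ ⟫ ⊩ p) × (⟪ τ ⟫ ⊩ p → h ⊩ p)
  agree h (atom k) hτ p⊆M = agree-modal h _ hτ (p⊆M (here refl))
  agree h (~ p)    hτ p⊆M with f , g ← agree h p hτ p⊆M = _∘ g , _∘ f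
  agree h (p ∧ q)  hτ p⊆M
    with f , g ← agree h p hτ (p⊆M ∘ ∈-++⁺ˡ) | f′ , g′ ← agree h q hτ (p⊆M ∘ ∈-++⁺ʳ (modals p))
    = Prod.map f f′ , Prod.map g g′
  agree h (p > q)  hτ p⊆M = agree-modal h _ hτ (p⊆M (here refl))

  χ-decides : ∀ p → modals p ⊆ M → ⟪ τ ⟫ ⊩ p → ⊢ χ τ ⇒ p
  χ-decides p p⊆M τp = tautology λ h → ⊩-⇒⁺ h (χ τ) p λ hτ → proj₂ (agree h p hτ p⊆M) τp

-- Scheduling

-- An increasing family on a finite list has a stage that adds nothing. If `x` enters just after the
-- stage found for `xs`, the search for `xs` restarts from there; `x` is then in for good.
stabilise : ∀ {A : Set} (P : ℕ → Pred A 0ℓ) → (∀ k → Decidable (P k)) →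
            (∀ {k l x} → k ≤ l → P k x → P l x) →
            ∀ xs k → ∃ λ K → k ≤ K × (∀ {x} → x ∈ xs → P (suc K) x → P K x)
stabilise P P? mono []       k = k , ℕ.≤-refl , λ ()
stabilise P P? mono (x ∷ xs) k with stabilise P P? mono xs k
... | K , k≤K , stable with P? (suc K) x →-dec P? K x
...   | yes Px = K , k≤K , λ { (here refl) → Px ; (there x∈) → stable x∈ }
...   | no ¬Px with stabilise P P? mono xs (suc K)
...     | L , K<L , stable′ =
  L , ℕ.≤-trans k≤K (ℕ.<⇒≤ K<L) , λ where
    (here refl) _ → mono K<L (decidable-stable (P? (suc K) x) λ ¬p → ¬Px λ p → contradiction p ¬p)
    (there x∈)    → stable′ x∈

module Schedule {n m} (E : Rel (Fin n) 0ℓ) (E-refl : Reflexive E) (E? : Binary.Decidable E)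
                (Goal : Fin (suc m) → Pred (Fin n) 0ℓ) (Goal? : ∀ j → Decidable (Goal j)) where

  Reach : Fin (suc m) → ℕ → Pred (Fin n) 0ℓ
  Reach j zero    i = Goal j i
  Reach j (suc k) i = ∃ λ i′ → E i i′ × Reach j k i′

  reach? : ∀ j k → Decidable (Reach j k)
  reach? j zero    i = Goal? j i
  reach? j (suc k) i = Fin.any? λ i′ → E? i i′ ×-dec reach? j k i′

  Reach-suc : ∀ {j} k {i} → Reach j k i → Reach j (suc k) i
  Reach-suc k r = _ , E-refl , r

  Reach-mono : ∀ {j k l i} → k ≤ l → Reach j k i → Reach j l i
  Reach-mono {l = zero}  z≤n       r = r
  Reach-mono {l = suc l} z≤n       r = Reach-suc l (Reach-mono {k = zero} {l} z≤n r)
  Reach-mono             (s≤s k≤l) (i′ , e , r) = i′ , e , Reach-mono k≤l r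

  abstract
    stable : ∃ λ K → ∀ j i → Reach j (suc K) i → Reach j K i
    stable with stabilise (λ k (j , i) → Reach j k i) (λ k (j , i) → reach? j k i) Reach-mono
                          (cartesianProduct (allFin _) (allFin _)) 0
    ... | K , _ , f = K , λ j i → f (∈-cartesianProduct⁺ (∈-allFin j) (∈-allFin i))

  K : ℕ
  K = proj₁ stable

  -- As E is reflexive, paths of length K account for all paths.
  Reachable : Fin (suc m) → Pred (Fin n) 0ℓ
  Reachable j = Reach j K

  reachable? : ∀ j → Decidable (Reachable j)
  reachable? j = reach? j K

  -- The prolonged path has length `suc K`, and `stable` brings it back to `K`. Contrapositively,
  -- unreachability persists along edges.
  Reachable-back : ∀ {j i i′} → E i i′ → Reachable j i′ → Reachable j i
  Reachable-back {j} e r = proj₂ stable j _ (_ , e , r)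

  Goal⇒Reachable : ∀ {j i} → Goal j i → Reachable j i
  Goal⇒Reachable {j} = Reach-mono {j} {zero} {K} z≤n

  -- The current node, the goal being pursued, and the number of moves left
  -- before the next goal in cyclic order takes over.
  State : Set
  State = Fin n × Fin (suc m) × Fin (suc K)

  node : State → Fin n
  node = proj₁

  move : Fin (suc m) → ℕ → Fin n → Fin n
  move j k i with reach? j (suc k) i
  ... | yes (i′ , _) = i′
  ... | no  _        = i

  move-E : ∀ j k i → E i (move j k i)
  move-E j k i with reach? j (suc k) i
  ... | yes (_ , e , _) = e
  ... | no  _           = E-refl

  move-Reach : ∀ j k i → Reach j (suc k) i → Reach j k (move j k i)
  move-Reach j k i r with reach? j (suc k) i
  ... | yes (_ , _ , r′) = r′
  ... | no  ¬r           = contradiction r ¬r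

  step : State → State
  step (i , j     , suc k) = move j (toℕ k) i , j , inject₁ k
  -- The turn is over. Goals take turns in decreasing order, and `zero` hands over to the greatest
  -- one, each starting with the full allowance of `K` moves.
  step (i , suc j , zero)  = i , inject₁ j , fromℕ K
  step (i , zero  , zero)  = i , fromℕ m , fromℕ K

  step-E : ∀ x → E (node x) (node (step x))
  step-E (i , j     , suc k) = move-E j (toℕ k) i
  step-E (i , suc j , zero)  = E-refl
  step-E (i , zero  , zero)  = E-refl

  module _ (σ : ℕ → State) (orbit : ∀ t → σ (suc t) ≡ step (σ t)) where

    Visits : State → Set
    Visits x = ∃ λ t → σ t ≡ x

    next : ∀ {x} → Visits x → Visits (step x)
    next (t , refl) = suc t , orbit t

    -- Each `move` lowers the bound on the distance to the goal together with the counter, so a goal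
    -- within `k` moves has been reached when the counter is `zero`.
    countdown : ∀ j k i → Visits (i , j , k) →
                ∃ λ i′ → Visits (i′ , j , zero) × (Reach j (toℕ k) i → Goal j i′)
    countdown j = <-weakInduction
      (λ k → ∀ i → Visits (i , j , k) →
        ∃ λ i′ → Visits (i′ , j , zero) × (Reach j (toℕ k) i → Goal j i′))
      (λ i v → i , v , id)
      (λ k ih i v → let i′ , v′ , f = ih (move j (toℕ k) i) (next v) in
        i′ , v′ , λ r → f (subst (λ l → Reach j l (move j (toℕ k) i)) (sym (Fin.toℕ-inject₁ k))
                               (move-Reach j (toℕ k) i r)))

    visits-zero : ∃ λ i → Visits (i , zero , zero)
    visits-zero with σ 0 in eq
    ... | i₀ , j₀ , k₀ = let i , v , _ = countdown j₀ k₀ i₀ (0 , eq) in lower j₀ i v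
      where
      lower : ∀ j i → Visits (i , j , zero) → ∃ λ i → Visits (i , zero , zero)
      lower = <-weakInduction (λ j → ∀ i → Visits (i , j , zero) → ∃ λ i → Visits (i , zero , zero))
        (λ i v → i , v)
        (λ j ih i v → let i′ , v′ , _ = countdown (inject₁ j) (fromℕ K) i (next v) in ih i′ v′)

    -- The end of the turn of goal `zero` starts that of the greatest goal; from there every turn
    -- leads to the start of the one below.
    visits-start : ∀ j → ∃ λ i → Visits (i , j , fromℕ K)
    visits-start = >-weakInduction (λ j → ∃ λ i → Visits (i , j , fromℕ K))
      (let i , v = visits-zero in i , next v)
      (λ j (i , v) → let i′ , v′ , _ = countdown (suc j) (fromℕ K) i v in i′ , next v′)

    -- At the start of its turn `j` is either unreachable, which settles the matter, or within `K`
    -- moves, which is exactly the allowance of that turn.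
    fair : ∀ j → ∃ λ t → Goal j (node (σ t)) ⊎ ¬ Reachable j (node (σ t))
    fair j with i , v@(t , σt≡) ← visits-start j with reachable? j i
    ... | no ¬r = t , inj₂ (subst (λ x → ¬ Reachable j (node x)) (sym σt≡) ¬r)
    ... | yes r with _ , (t′ , σt′≡) , f ← countdown j (fromℕ K) i v =
      t′ , inj₁ (subst (λ x → Goal j (node x)) (sym σt′≡)
                  (f (subst (λ l → Reach j l i) (sym (Fin.toℕ-fromℕ K)) r)))

-- Sequence frames

IsRank-unique : ∀ {P : Set} (σ : ℕ → P) {τ m n} → IsRank σ τ m → IsRank σ τ n → m ≡ n
IsRank-unique σ (τ≗m , m≤) (τ≗n , n≤) = ℕ.≤-antisym (m≤ _ τ≗n) (n≤ _ τ≗m)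

IsRank-resp : ∀ {P : Set} {σ σ′ τ τ′ : ℕ → P} {n} → σ ≗ σ′ → τ ≗ τ′ → IsRank σ τ n → IsRank σ′ τ′ n
IsRank-resp {n = n} σ≗ τ≗ (τ≗n , n≤) =
    (λ k → trans (sym (τ≗ k)) (trans (τ≗n k) (σ≗ (n + k))))
  , λ m τ′≗m → n≤ m λ k → trans (τ≗ k) (trans (τ′≗m k) (sym (σ≗ (m + k))))

IsRank-self : ∀ {P : Set} {σ : ℕ → P} → IsRank σ σ 0
IsRank-self = (λ _ → refl) , λ _ _ → z≤n

module _ {P : Set} (U : Pred (ℕ → P) 0ℓ) where
  open Setoid (sequences U) using (_≈_; isEquivalence)

  -- Ranks are unique, so the order is pulled back from the natural numbers. Carrying the rank in
  -- the domain makes comparison decidable: equality of tails becomes equality of ranks.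
  tailOrder-isStrictWellOrderOn : ∀ σ →
    IsStrictWellOrderOn (sequences U) (λ τ → ∃ (IsRank (proj₁ σ) (proj₁ τ))) (tailOrder U σ)
  tailOrder-isStrictWellOrderOn σ = record
    { respects           = λ x≈y (n , r) → n , resp x≈y r
    ; on-subset          = λ (m , n , rm , rn , _) → (m , rm) , (n , rn)
    ; isStrictTotalOrder = record
      { isStrictPartialOrder = record
        { isEquivalence = On.isEquivalence proj₁ isEquivalence
        ; irrefl        = λ x≈y (m , n , rm , rn , m<n) →
            ℕ.<-irrefl (IsRank-unique (proj₁ σ) (resp x≈y rm) rn) m<n
        ; trans         = λ (m , n , rm , rn , m<n) (n′ , o , rn′ , ro , n′<o) →
            m , o , rm , ro , ℕ.<-trans m<n (subst (_< o) (IsRank-unique (proj₁ σ) rn′ rn) n′<o)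
        ; <-resp-≈      =
            (λ y≈z (m , n , rm , rn , m<n) → m , n , rm , resp y≈z rn , m<n)
          , (λ y≈z (m , n , rm , rn , m<n) → m , n , resp y≈z rm , rn , m<n)
        }
      ; compare = compare
      }
    ; wellFounded = Subrelation.wellFounded
        (λ {x} {y} → lt⇒< x y) (On.wellFounded (λ (_ , n , _) → n) <-wellFounded)
    }
    where
    D : Set
    D = ∃ λ τ → ∃ (IsRank (proj₁ σ) (proj₁ {B = U} τ))

    rank : D → ℕ
    rank (_ , n , _) = n

    resp : ∀ {n} {τ τ′ : ℕ → P} → τ ≗ τ′ → IsRank (proj₁ σ) τ n → IsRank (proj₁ σ) τ′ n
    resp = IsRank-resp {σ = proj₁ σ} (λ _ → refl)

    lt⇒< : ∀ (x y : D) → tailOrder U σ (proj₁ x) (proj₁ y) → rank x < rank y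
    lt⇒< (_ , _ , rx) (_ , _ , ry) (_ , _ , rm , rn , m<n) =
      subst₂ _<_ (IsRank-unique (proj₁ σ) rm rx) (IsRank-unique (proj₁ σ) rn ry) m<n

    compare : ∀ (x y : D) → Tri (tailOrder U σ (proj₁ x) (proj₁ y)) (proj₁ x ≈ proj₁ y)
                                (tailOrder U σ (proj₁ y) (proj₁ x))
    compare x@(_ , m , rx) y@(_ , n , ry) with ℕ.<-cmp m n
    ... | tri< m<n m≢n n≮m = tri< (m , n , rx , ry , m<n)
                                  (λ x≈y → m≢n (IsRank-unique (proj₁ σ) (resp x≈y rx) ry))
                                  (λ y<x → n≮m (lt⇒< y x y<x))
    ... | tri≈ m≮n refl n≮m = tri≈ (λ x<y → m≮n (lt⇒< x y x<y))
                                   (λ k → trans (proj₁ rx k) (sym (proj₁ ry k)))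
                                   (λ y<x → n≮m (lt⇒< y x y<x))
    ... | tri> m≮n m≢n n<m = tri> (λ x<y → m≮n (lt⇒< x y x<y))
                                  (λ x≈y → m≢n (IsRank-unique (proj₁ σ) (resp x≈y rx) ry))
                                  (n , m , ry , rx , n<m)

  tailOrder-centered : ∀ {σ τ ρ} → tailOrder U σ τ ρ → σ ≈ τ ⊎ tailOrder U σ σ τ
  tailOrder-centered (zero  , _ , (τ≗ , _) , _) = inj₁ λ k → sym (τ≗ k)
  tailOrder-centered (suc m , _ , rτ , _)       = inj₂ (0 , suc m , IsRank-self , rτ , s≤s z≤n)

  tailOrder-isOrderFrame : ∃ U → IsOrderFrame (sequences U) (tailOrder U)
  tailOrder-isOrderFrame σ₀ = record
    { nonempty  = σ₀
    ; lt-cong   = λ w≈w′ (m , n , rm , rn , m<n) →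
        m , n , IsRank-resp w≈w′ (λ _ → refl) rm , IsRank-resp w≈w′ (λ _ → refl) rn , m<n
    ; wellOrder = λ σ → _ , tailOrder-isStrictWellOrderOn σ
    ; centered  = λ {w} {x} {y} → tailOrder-centered {w} {x} {y}
    }

-- The truth clause for conditionals in terms of positions in a sequence.

module _ (F : ωSequenceFrame) (V : Valuation (orderFrame F)) where
  open ωSequenceFrame F using (closed)
  open OrderModel (model (orderFrame F) V) using (⟦_⟧; _≈_; R)

  drop : ℕ → W (orderFrame F) → W (orderFrame F)
  drop n (σ , σ∈) = tail n σ , closed n σ∈

  module _ {a b : Form} (a-resp : ⟦ a ⟧ Respects _≈_) (σ : W (orderFrame F)) where

    >-none : (∀ n → ¬ ⟦ a ⟧ (drop n σ)) → ⟦ a > b ⟧ σ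
    >-none ¬a = inj₁ λ where
      τ (inj₁ τ≈σ , aτ)                       → ¬a 0 (a-resp τ≈σ aτ)
      τ (inj₂ (_ , n , _ , (τ≗ , _) , _) , aτ) → ¬a n (a-resp τ≗ aτ)

    Least : ℕ → Set
    Least n = ⟦ a ⟧ (drop n σ) × (∀ m → m < n → ¬ ⟦ a ⟧ (drop m σ))

    -- The same tail at an earlier position would satisfy `a` there, against leastness; hence the
    -- position is the rank.
    least-rank : ∀ {n} → Least n → IsRank (proj₁ σ) (tail n (proj₁ σ)) n
    least-rank (an , least) =
      (λ _ → refl) , λ m eq → ℕ.≮⇒≥ λ m<n → least m m<n (a-resp eq an)

    least-R : ∀ {n} → Least n → R σ (drop n σ)
    least-R {zero}  L = inj₁ λ _ → refl
    least-R {suc n} L = inj₂ (0 , suc n , IsRank-self , least-rank L , s≤s z≤n)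

    >-least⁺ : ∀ {n} → Least n → ⟦ b ⟧ (drop n σ) → ⟦ a > b ⟧ σ
    >-least⁺ {n} L@(an , least) bn = inj₂ (drop n σ , (least-R L , an , bn) , λ where
      τ (m , _ , (τ≗ , _) , rn , m<) aτ →
        least m (subst (m <_) (IsRank-unique (proj₁ σ) rn (least-rank L)) m<) (a-resp τ≗ aτ))

    >-least⁻ : ∀ {n} → ⟦ b ⟧ Respects _≈_ → Least n → ⟦ a > b ⟧ σ → ⟦ b ⟧ (drop n σ)
    >-least⁻ {n} b-resp L@(an , _) (inj₁ empty) = contradiction (least-R L , an) (empty (drop n σ))
    >-least⁻ {zero}  b-resp L (inj₂ (τ , (inj₁ τ≈σ , aτ , bτ) , _)) = b-resp τ≈σ bτ
    >-least⁻ {suc n} b-resp (_ , least) (inj₂ (τ , (inj₁ τ≈σ , aτ , bτ) , _)) =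
      contradiction (a-resp τ≈σ aτ) (least 0 (s≤s z≤n))
    >-least⁻ {n} b-resp L@(an , least)
             (inj₂ (τ , (inj₂ (_ , l , _ , rl@(τ≗ , _) , _) , aτ , bτ) , none))
      with ℕ.<-cmp l n
    ... | tri< l<n _ _  = contradiction (a-resp τ≗ aτ) (least l l<n)
    ... | tri≈ _ refl _ = b-resp τ≗ bτ
    ... | tri> _ _ n<l  = contradiction an (none (drop n σ) (n , l , least-rank L , rl , n<l))

-- Orbits of a deterministic step function.

module Orbits {Y : Set} (step : Y → Y) (y₀ : Y) where

  IsOrbit : Pred (ℕ → Y) 0ℓ
  IsOrbit σ = ∀ t → σ (suc t) ≡ step (σ t)

  orbit : Y → ∃ IsOrbit
  orbit y = fold y step , λ _ → refl

  frame : ωSequenceFrame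
  frame = record
    { P            = Y
    ; W            = IsOrbit
    ; W-resp       = λ σ≗τ o t → trans (sym (σ≗τ (suc t))) (trans (o t) (cong step (σ≗τ t)))
    ; closed       = λ n {σ} o t → trans (cong σ (ℕ.+-suc n t)) (o (n + t))
    ; isOrderFrame = tailOrder-isOrderFrame IsOrbit (orbit y₀)
    }

  -- An orbit is determined by its first state, so worlds correspond to states.
  frame-finite : ∀ {n} → Fin n ↔ Y → Finite frame
  frame-finite {n} Fin↔Y = n , record
    { to        = λ (σ , _) → from (σ 0)
    ; from      = λ i → orbit (to i)
    ; to-cong   = λ σ≗τ → cong from (σ≗τ 0)
    ; from-cong = λ { refl _ → refl }
    ; inverse   = (λ σ≗ → trans (cong from (σ≗ 0)) (strictlyInverseʳ _))
                , λ { {σ , o} refl → determined σ o }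
    }
    where
    open Inverse Fin↔Y
    determined : ∀ σ → IsOrbit σ → fold (to (from (σ 0))) step ≗ σ
    determined σ o zero    = strictlyInverseˡ (σ 0)
    determined σ o (suc t) = trans (cong step (determined σ o t)) (sym (o t))

-- Types closed under realising their pending antecedents

least? : ∀ {P : Pred ℕ 0ℓ} → Decidable P → ∀ t →
         (∃ λ n → P n × (∀ m → m < n → ¬ P m)) ⊎ (∀ n → n < t → ¬ P n)
least? P? zero = inj₂ λ _ ()
least? P? (suc t) with least? P? t
... | inj₁ found = inj₁ found
... | inj₂ none with P? t
...   | yes Pt = inj₁ (t , Pt , none)
...   | no ¬Pt = inj₂ λ n n<1+t → [ none n , (λ { refl → ¬Pt }) ]′ (ℕ.m<1+n⇒m<n∨m≡n n<1+t)

conditionals : Form → List (Form × Form)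
conditionals (atom k) = []
conditionals (~ p)    = conditionals p
conditionals (p ∧ q)  = conditionals p ++ conditionals q
conditionals (p > q)  = (p , q) ∷ conditionals p ++ conditionals q

∈-removeAt : ∀ {A : Set} (xs : List A) i j → i ≢ j → lookup xs j ∈ removeAt xs i
∈-removeAt (x ∷ xs) zero    zero    i≢j = contradiction refl i≢j
∈-removeAt (x ∷ xs) zero    (suc j) i≢j = ∈-lookup j
∈-removeAt (x ∷ xs) (suc i) zero    i≢j = here refl
∈-removeAt (x ∷ xs) (suc i) (suc j) i≢j = there (∈-removeAt xs i j (i≢j ∘ cong suc))

-- The conditionals form a non-empty list because the scheduler cycles through their antecedents as
-- its goals.
module Completeness (c : Form × Form) (cs : List (Form × Form)) where

  pair : Fin (suc (length cs)) → Form × Form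
  pair = lookup (c ∷ cs)

  ante cons cond : Fin (suc (length cs)) → Form
  ante j = proj₁ (pair j)
  cons j = proj₂ (pair j)
  cond j = ante j > cons j

  parts : Form × Form → List Form
  parts (p , q) = (p > q) ∷ modals p ++ modals q

  -- Besides each conditional, `M` has the modals of its antecedent and consequent, so that a type
  -- decides all three.
  M : List Form
  M = concatMap parts (c ∷ cs)

  parts⊆M : ∀ j → parts (pair j) ⊆ M
  parts⊆M j v∈ = ∈-concatMap⁺ parts {xs = c ∷ cs} (lose (∈-lookup {xs = c ∷ cs} j) v∈)

  cond⊆M : ∀ j → modals (cond j) ⊆ M
  cond⊆M j (here refl) = parts⊆M j (here refl)

  ante⊆M : ∀ j → modals (ante j) ⊆ M
  ante⊆M j = parts⊆M j ∘ there ∘ ∈-++⁺ˡ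

  cons⊆M : ∀ j → modals (cons j) ⊆ M
  cons⊆M j = parts⊆M j ∘ there ∘ ∈-++⁺ʳ (modals (ante j))

  infix 4 _⟶_ _⟶?_

  -- τ′ may hold at the first world where τ fails, or where τ holds.
  _⟶_ : Rel (Type M) 0ℓ
  τ ⟶ τ′ = ∀ j → ¬ ⟪ τ ⟫ ⊩ ante j → ⟪ τ ⟫ (cond j) ≡ ⟪ τ′ ⟫ (cond j)

  _⟶?_ : Binary.Decidable _⟶_
  τ ⟶? τ′ = Fin.all? λ j → ¬? (⟪ τ ⟫ ⊩? ante j) →-dec (⟪ τ ⟫ (cond j) Bool.≟ ⟪ τ′ ⟫ (cond j))

  -- Some conditional whose antecedent fails in `τ` has different values in the two types. Its value
  -- in `τ` persists to the first world where `χ τ` fails, and there contradicts `χ τ′`.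
  ⟶-excludes : ∀ τ τ′ → ¬ (τ ⟶ τ′) → ⊢ χ τ ⇒ (~ χ τ > ~ χ τ′)
  ⟶-excludes τ τ′ ¬⟶
    with j , ¬keeps ← Fin.¬∀⟶∃¬ _ _
           (λ j → ¬? (⟪ τ ⟫ ⊩? ante j) →-dec (⟪ τ ⟫ (cond j) Bool.≟ ⟪ τ′ ⟫ (cond j))) ¬⟶
    with ⟪ τ ⟫ ⊩? ante j
  ... | yes τa = contradiction (λ ¬τa → contradiction τa ¬τa) ¬keeps
  ... | no ¬τa = cases (⟪ τ ⟫ ⊩? cond j) (⟪ τ′ ⟫ ⊩? cond j)
    where
    χ⇒~a : ⊢ χ τ ⇒ ~ ante j
    χ⇒~a = χ-decides τ (~ ante j) (ante⊆M j) ¬τa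
    cases : Dec (⟪ τ ⟫ ⊩ cond j) → Dec (⟪ τ′ ⟫ ⊩ cond j) → ⊢ χ τ ⇒ (~ χ τ > ~ χ τ′)
    cases (yes τu) (yes τ′u) = contradiction (λ _ → trans τu (sym τ′u)) ¬keeps
    cases (no ¬τu) (no ¬τ′u) =
      contradiction (λ _ → trans (Bool.¬-not ¬τu) (sym (Bool.¬-not ¬τ′u))) ¬keeps
    cases (yes τu) (no ¬τ′u) = ⇒-trans
      (persist⁺ (ante j) (cons j) χ⇒~a (χ-decides τ (cond j) (cond⊆M j) τu))
      (>-mono (~ χ τ) (⇒~-sym (χ-decides τ′ (~ cond j) (cond⊆M j) ¬τ′u)))
    cases (no ¬τu) (yes τ′u) = ⇒-trans
      (persist⁻ (ante j) (cons j) χ⇒~a (χ-decides τ (~ cond j) (cond⊆M j) ¬τu))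
      (>-mono (~ χ τ) (contraposition (χ-decides τ′ (cond j) (cond⊆M j) τ′u)))

  Local : Type M → Fin (suc (length cs)) → Set
  Local τ j = ⟪ τ ⟫ ⊩ ante j →
    (⟪ τ ⟫ ⊩ cond j → ⟪ τ ⟫ ⊩ cons j) × (⟪ τ ⟫ ⊩ cons j → ⟪ τ ⟫ ⊩ cond j)

  local? : ∀ τ → Decidable (Local τ)
  local? τ j = (⟪ τ ⟫ ⊩? ante j) →-dec
    (((⟪ τ ⟫ ⊩? cond j) →-dec (⟪ τ ⟫ ⊩? cons j)) ×-dec ((⟪ τ ⟫ ⊩? cons j) →-dec (⟪ τ ⟫ ⊩? cond j)))

  -- Where the antecedent holds, the two centering theorems make the conditional equivalent to its
  -- consequent.
  ¬local⇒refutable : ∀ τ j → ¬ Local τ j → ⊢ ~ χ τ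
  ¬local⇒refutable τ j ¬local = infer₂
    (λ h c⁻ c⁺ hτ →
      let a⇒ , a⇐ = agree τ h (ante j) hτ (ante⊆M j)
          b⇒ , b⇐ = agree τ h (cons j) hτ (cons⊆M j)
          u⇒ , u⇐ = agree τ h (cond j) hτ (cond⊆M j)
      in ¬local λ τa →
          (λ τu → b⇒ (⊩-⇒⁻ h (ante j) (cons j)
                       (⊩-⇒⁻ h (cond j) (ante j ⇒ cons j) c⁻ (u⇐ τu)) (a⇐ τa)))
        , (λ τb → u⇒ (⊩-⇒⁻ h (ante j ∧ cons j) (cond j) c⁺ (a⇐ τa , b⇐ τb))))
    (centering⁻ (ante j) (cons j)) (centering⁺ (ante j) (cons j))

  ⊩-⋁χ⁻ : ∀ h S → h ⊩ ⋁ (map χ S) → ∃ λ i → h ⊩ χ {M} (lookup S i)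
  ⊩-⋁χ⁻ h S hS with _ , p∈ , hp ← ⊩-⋁⁻ h (map χ S) hS with τ , τ∈ , refl ← ∈-map⁻ χ p∈ =
    index τ∈ , subst (λ υ → h ⊩ χ υ) (Any.lookup-index τ∈) hp

  -- Refutation of types with an unreachable antecedent.

  module Graph (S : List (Type M)) where

    at : Fin (length S) → Type M
    at = lookup S

    open Schedule (λ i i′ → at i ⟶ at i′) (λ _ _ → refl) (λ i i′ → at i ⟶? at i′)
                  (λ j i → ⟪ at i ⟫ ⊩ ante j) (λ j i → ⟪ at i ⟫ ⊩? ante j) public

    -- A conditional can fail only if there is a first antecedent world, so a type that rejects it
    -- must have a path to its antecedent.
    Good : Fin (length S) → Fin (suc (length cs)) → Set
    Good i j = Local (at i) j × (¬ ⟪ at i ⟫ ⊩ cond j → Reachable j i)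

    good? : ∀ i → Decidable (Good i)
    good? i j = local? (at i) j ×-dec (¬? (⟪ at i ⟫ ⊩? cond j) →-dec reachable? j i)

    module _ (⊢S : ⊢ ⋁ (map χ S)) where

      module _ (j : Fin (suc (length cs))) where

        -- ¬ Reachable j is closed under ⟶, so Sequentiality applies to the
        -- disjunction of the types satisfying it.
        inside outside : List (Fin (length S))
        inside  = filter (¬? ∘ reachable? j) (allFin _)
        outside = filter (reachable? j) (allFin _)

        trap : Form
        trap = ⋁ (map (χ ∘ at) inside)

        ∈-inside : ∀ {i} → ¬ Reachable j i → χ (at i) ∈ map (χ ∘ at) inside
        ∈-inside {i} ¬r = ∈-map⁺ (χ ∘ at) (∈-filter⁺ (¬? ∘ reachable? j) (∈-allFin i) ¬r)

        trap⇒~ante : ⊢ trap ⇒ ~ ante j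
        trap⇒~ante = ⋁-⇒ (map (χ ∘ at) inside) λ p∈ →
          let i , i∈ , p≡ = ∈-map⁻ (χ ∘ at) p∈
              _ , ¬r = ∈-filter⁻ (¬? ∘ reachable? j) {xs = allFin _} i∈
          in subst (λ p → ⊢ p ⇒ ~ ante j) (sym p≡)
               (χ-decides (at i) (~ ante j) (ante⊆M j) (¬r ∘ Goal⇒Reachable))

        outside-exhausted : ⊢ ⋀ (map (~_ ∘ χ ∘ at) outside) ⇒ trap
        outside-exhausted = infer (λ h hS → ⊩-⇒⁺ h (⋀ (map (~_ ∘ χ ∘ at) outside)) trap λ hout →
          let i , hi = ⊩-⋁χ⁻ h S hS in
          ⊩-⋁⁺ h (∈-inside λ r → ⊩-⋀⁻ h {map (~_ ∘ χ ∘ at) outside}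
            (∈-map⁺ (~_ ∘ χ ∘ at) (∈-filter⁺ (reachable? j) (∈-allFin i) r)) hout hi) hi) ⊢S

        -- A type that reaches the goal is no ⟶-successor of `at i`, since `at i` would then reach
        -- it too. With all of these excluded, only the types in `trap` are left at the first world
        -- where `χ (at i)` fails.
        stays : ∀ {i} → ¬ Reachable j i → ⊢ χ (at i) ⇒ (~ χ (at i) > trap)
        stays {i} ¬r = ⇒-trans
          (>-⋀ (map (~_ ∘ χ ∘ at) outside) λ p∈ →
            let o , o∈ , p≡ = ∈-map⁻ (~_ ∘ χ ∘ at) p∈
                _ , r = ∈-filter⁻ (reachable? j) {xs = allFin _} o∈
            in subst (λ p → ⊢ χ (at i) ⇒ (~ χ (at i) > p)) (sym p≡)
                 (⟶-excludes (at i) (at o) λ e → ¬r (Reachable-back e r)))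
          (>-mono (~ χ (at i)) outside-exhausted)

        -- The common consequent in `sequential-⋁` is taken to be `trap` itself.
        trap⇒□trap : ⊢ trap ⇒ □ trap
        trap⇒□trap = sequential-⋁ (map (χ ∘ at) inside) λ p∈ →
          let i , i∈ , p≡ = ∈-map⁻ (χ ∘ at) p∈
              _ , ¬r = ∈-filter⁻ (¬? ∘ reachable? j) {xs = allFin _} i∈
          in subst (λ p → ⊢ p ⇒ (~ p > trap)) (sym p≡) (stays ¬r)

        -- The type belongs to `trap`, which excludes the antecedent and is never left, so the
        -- conditional is vacuous.
        unreachable⇒cond : ∀ i → ¬ Reachable j i → ⊢ χ (at i) ⇒ cond j
        unreachable⇒cond i ¬r = ⇒-trans
          (tautology λ h → ⊩-⇒⁺ h (χ (at i)) trap (⊩-⋁⁺ h (∈-inside ¬r)))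
          (vacuous (cons j) trap⇒~ante trap⇒□trap)

      ¬good⇒refutable : ∀ i j → ¬ Good i j → ⊢ ~ χ (at i)
      ¬good⇒refutable i j ¬good = cases (local? (at i) j) (reachable? j i)
        where
        cases : Dec (Local (at i) j) → Dec (Reachable j i) → ⊢ ~ χ (at i)
        cases (no ¬local) _       = ¬local⇒refutable (at i) j ¬local
        cases (yes local) (yes r) = contradiction (local , λ _ → r) ¬good
        cases (yes local) (no ¬r) = infer
          (λ h χ⇒u hχ → ¬good (local , λ ¬u → contradiction
            (proj₁ (agree (at i) h (cond j) hχ (cond⊆M j)) (⊩-⇒⁻ h (χ (at i)) (cond j) χ⇒u hχ)) ¬u))
          (unreachable⇒cond j i ¬r)

  open Graph using (Good; good?; ¬good⇒refutable)

  -- Deleting a refutable type keeps the disjunction provable and shortens the list. Paths may be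
  -- lost by a deletion, so goodness is tested afresh on the shorter list.
  eliminate : ∀ S → Acc _<_ (length S) → ⊢ ⋁ (map χ S) →
              ∃ λ S → ⊢ ⋁ (map χ S) × (∀ i j → Good S i j)
  eliminate S (acc rec) ⊢S = cases (Fin.all? allGood?)
    where
    allGood? : ∀ i → Dec (∀ j → Good S i j)
    allGood? i = Fin.all? (good? S i)

    remove : (∃ λ i → ∃ λ j → ¬ Good S i j) → ∃ λ S → ⊢ ⋁ (map χ S) × (∀ i j → Good S i j)
    remove (i , j , ¬good) =
      eliminate (removeAt S i) (rec (ℕ.≤-reflexive (sym (length-removeAt′ S i))))
        -- Some `lookup S k` holds, and `k` differs from `i` because the type at `i` is refuted.
        (infer₂ (λ h hS ¬hi → let k , hk = ⊩-⋁χ⁻ h S hS in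
            ⊩-⋁⁺ h (∈-map⁺ χ (∈-removeAt S i k λ { refl → ¬hi hk })) hk)
          ⊢S (¬good⇒refutable S ⊢S i j ¬good))

    cases : Dec (∀ i j → Good S i j) → ∃ λ S → ⊢ ⋁ (map χ S) × (∀ i j → Good S i j)
    cases (yes good) = S , ⊢S , good
    cases (no ¬good) =
      let i , ¬goodᵢ = Fin.¬∀⟶∃¬ _ _ allGood? ¬good
      in remove (i , Fin.¬∀⟶∃¬ _ _ (good? S i) ¬goodᵢ)

  -- The model of scheduled orbits and its truth lemma.

  module Model (S : List (Type M)) (good : ∀ i j → Good S i j) (i₀ : Fin (length S)) where
    open Graph S using (at; node; step; step-E; fair; Reachable; Reachable-back; Goal⇒Reachable)
    -- This state supplies the element that makes the frame non-empty; the worlds are the orbits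
    -- from all states.
    open Orbits step (i₀ , zero , zero) public

    typeAt : W (orderFrame frame) → ℕ → Type M
    typeAt (σ , _) t = at (node (σ t))

    valuation : Valuation (orderFrame frame)
    valuation = record
      { val      = λ k σ → ⟪ typeAt σ 0 ⟫ (atom k)
      ; val-cong = λ k σ≗τ → cong (λ x → ⟪ at (node x) ⟫ (atom k)) (σ≗τ 0)
      }

    open OrderModel (model (orderFrame frame) valuation) using (⟦_⟧; _≈_)

    finite : Finite frame
    finite = frame-finite (↔-trans Fin.*↔× (↔-refl ×-↔ Fin.*↔×))

    Truth : Pred Form 0ℓ
    Truth p = ∀ σ → (⟦ p ⟧ σ → ⟪ typeAt σ 0 ⟫ ⊩ p) × (⟪ typeAt σ 0 ⟫ ⊩ p → ⟦ p ⟧ σ)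

    Truth⇒resp : ∀ {p} → Truth p → ⟦ p ⟧ Respects _≈_
    Truth⇒resp {p} truth {σ} {τ} σ≗τ pσ =
      proj₂ (truth τ) (subst (λ x → ⟪ at (node x) ⟫ ⊩ p) (σ≗τ 0) (proj₁ (truth σ) pσ))

    module _ (j : Fin (suc (length cs))) (σ : W (orderFrame frame)) where

      steps : ∀ t → typeAt σ t ⟶ typeAt σ (suc t)
      steps t = subst (λ x → typeAt σ t ⟶ at (node x)) (sym (proj₂ σ t)) (step-E (proj₁ σ t))

      -- A ⟶-step preserves the conditional whenever the antecedent fails at its source; at position
      -- `n` itself the antecedent may already hold.
      cond-constant : ∀ n → (∀ m → m < n → ¬ ⟪ typeAt σ m ⟫ ⊩ ante j) →
                      ⟪ typeAt σ 0 ⟫ (cond j) ≡ ⟪ typeAt σ n ⟫ (cond j)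
      cond-constant zero    ¬a = refl
      cond-constant (suc n) ¬a = trans (cond-constant n λ m m<n → ¬a m (ℕ.m<n⇒m<1+n m<n))
                                       (steps n j (¬a n (ℕ.n<1+n n)))

      unreachable-later : ∀ {t n} → t ≤′ n → ¬ Reachable j (node (proj₁ σ t)) →
                          ¬ Reachable j (node (proj₁ σ n))
      unreachable-later ≤′-refl            ¬r r = ¬r r
      unreachable-later (≤′-step {n} t≤′n) ¬r r =
        unreachable-later t≤′n ¬r (Reachable-back (steps n) r)

    -- `fair` gives a time at which the antecedent holds or is unreachable. If there is a first
    -- position where it holds, `Local` equates conditional and consequent there, and
    -- `cond-constant` carries this back to the start. Otherwise it never holds, so the conditional
    -- is vacuously true, and `Good` makes the type accept it.
    cond-truth : ∀ j → Truth (ante j) → Truth (cons j) → Truth (cond j)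
    cond-truth j truth-a truth-b σ@(σ₀ , o) = main
      where
      ⟦⟧⇒⊩ : ∀ {p} → Truth p → ∀ n → ⟦ p ⟧ (drop frame valuation n σ) → ⟪ typeAt σ n ⟫ ⊩ p
      -- The first state of `tail n` of a sequence is the one at `n + 0`.
      ⟦⟧⇒⊩ {p} truth n x = subst (λ t → ⟪ typeAt σ t ⟫ ⊩ p) (ℕ.+-identityʳ n) (proj₁ (truth _) x)

      ⊩⇒⟦⟧ : ∀ {p} → Truth p → ∀ n → ⟪ typeAt σ n ⟫ ⊩ p → ⟦ p ⟧ (drop frame valuation n σ)
      ⊩⇒⟦⟧ {p} truth n x = proj₂ (truth _) (subst (λ t → ⟪ typeAt σ t ⟫ ⊩ p) (sym (ℕ.+-identityʳ n)) x)

      a-resp : ⟦ ante j ⟧ Respects _≈_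
      a-resp = Truth⇒resp {ante j} truth-a

      Holds : ℕ → Set
      Holds n = ⟪ typeAt σ n ⟫ ⊩ ante j

      Result : Set
      Result = (⟦ cond j ⟧ σ → ⟪ typeAt σ 0 ⟫ ⊩ cond j) × (⟪ typeAt σ 0 ⟫ ⊩ cond j → ⟦ cond j ⟧ σ)

      at-least : ∀ n → Holds n → (∀ m → m < n → ¬ Holds m) → Result
      at-least n an before =
          (λ x → trans constant (proj₂ local (⟦⟧⇒⊩ {cons j} truth-b n
            (>-least⁻ frame valuation {ante j} {cons j} a-resp σ (Truth⇒resp {cons j} truth-b) L x))))
        , (λ u → >-least⁺ frame valuation {ante j} {cons j} a-resp σ L
            (⊩⇒⟦⟧ {cons j} truth-b n (proj₁ local (trans (sym constant) u))))
        where
        constant = cond-constant j σ n before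
        local = proj₁ (good (node (σ₀ n)) j) an
        L : Least frame valuation {ante j} {cons j} a-resp σ n
        L = ⊩⇒⟦⟧ {ante j} truth-a n an , λ m m<n x → before m m<n (⟦⟧⇒⊩ {ante j} truth-a m x)

      at-none : ∀ t → (∀ n → n < suc t → ¬ Holds n) → ¬ Reachable j (node (σ₀ t)) → Result
      at-none t ¬a ¬r =
          (λ _ → trans (cond-constant j σ t λ m m<t → ¬a m (ℕ.m<n⇒m<1+n m<t)) cond-later)
        , (λ _ → >-none frame valuation {ante j} {cons j} a-resp σ
                   λ n x → never n (n ℕ.<? suc t) (⟦⟧⇒⊩ {ante j} truth-a n x))
        where
        never : ∀ n → Dec (n < suc t) → ¬ Holds n
        never n (yes n<1+t) = ¬a n n<1+t
        never n (no  n≮1+t) = unreachable-later j σ (ℕ.≤⇒≤′ (ℕ.<⇒≤ (ℕ.≮⇒≥ n≮1+t))) ¬r ∘ Goal⇒Reachable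
        cond-later : ⟪ typeAt σ t ⟫ ⊩ cond j
        cond-later = decidable-stable (⟪ typeAt σ t ⟫ ⊩? cond j) (¬r ∘ proj₂ (good (node (σ₀ t)) j))

      cases : ∀ t → Holds t ⊎ ¬ Reachable j (node (σ₀ t)) →
              (∃ λ n → Holds n × (∀ m → m < n → ¬ Holds m)) ⊎ (∀ n → n < suc t → ¬ Holds n) → Result
      cases t _         (inj₁ (n , an , before)) = at-least n an before
      cases t (inj₁ at) (inj₂ ¬a)                = contradiction at (¬a t (ℕ.n<1+n t))
      cases t (inj₂ ¬r) (inj₂ ¬a)                = at-none t ¬a ¬r

      main : Result
      -- The bound `suc t` makes the search include the time `t` itself, where the antecedent may
      -- hold for the first time.
      main = let t , goal? = fair σ₀ o j in
        cases t goal? (least? (λ n → ⟪ typeAt σ n ⟫ ⊩? ante j) (suc t))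

    truth : ∀ p → conditionals p ⊆ c ∷ cs → Truth p
    truth (atom k) p⊆ σ = id , id
    truth (~ p)    p⊆ σ = let f , g = truth p p⊆ σ in _∘ g , _∘ f
    truth (p ∧ q)  p⊆ σ =
      let f , g = truth p (p⊆ ∘ ∈-++⁺ˡ) σ
          f′ , g′ = truth q (p⊆ ∘ ∈-++⁺ʳ (conditionals p)) σ
      in Prod.map f f′ , Prod.map g g′
    truth (p > q)  p⊆ = subst (λ (a , b) → Truth a → Truth b → Truth (a > b))
      (sym (Any.lookup-index pq∈)) (cond-truth (index pq∈))
      (truth p (p⊆ ∘ there ∘ ∈-++⁺ˡ)) (truth q (p⊆ ∘ there ∘ ∈-++⁺ʳ (conditionals p)))
      where pq∈ = p⊆ (here refl)

theorem5p4 : (p : Form) →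
    ((F : ωSequenceFrame) → Finite F →
    (V : Valuation (orderFrame F)) (w : W (orderFrame F)) →
    TrueAt (model (orderFrame F) V) w p) →
    ⊢C2FS p
theorem5p4 p valid = conclude (eliminate (types M) (<-wellFounded _) (tautology λ h →
    let τ , τ∈ , hτ = types-exhaustive h M in ⊩-⋁⁺ h (∈-map⁺ χ τ∈) hτ))
  where
  -- p > p serves to put p itself among the antecedents, so that types decide p.
  open Completeness (p , p) (conditionals p ++ conditionals p)

  -- The remaining type is that of the first state of an orbit. There `p` is true by `valid`, and
  -- the truth lemma turns this into acceptance by the type.
  forced : ∀ S → (∀ i j → Graph.Good S i j) → ∀ i → ⟪ lookup S i ⟫ ⊩ p
  forced S good i =
    proj₁ (truth p (there ∘ ∈-++⁺ˡ) world) (valid frame finite valuation world)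
    where
    open Model S good i
    world : W (orderFrame frame)
    world = orbit (i , zero , zero)

  conclude : (∃ λ S → ⊢ ⋁ (map χ S) × (∀ i j → Graph.Good S i j)) → ⊢ p
  conclude (S , ⊢S , good) = Detachment (⋁ (map χ S)) p
    (⋁-⇒ (map χ S) λ q∈ → let τ , τ∈ , q≡ = ∈-map⁻ χ q∈ in
      subst (λ q → ⊢ q ⇒ p) (sym q≡) (χ-decides τ p (ante⊆M zero)
        (subst (λ υ → ⟪ υ ⟫ ⊩ p) (sym (Any.lookup-index τ∈)) (forced S good (index τ∈)))))
    ⊢S
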